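{- Let $a,b,c$ be positive integers such that $\gcd(a,c)\mid b$, and let $r_a,r_c$ be integers such that $r_a a+r_c c=b$. For integers $k\ge 1$ and $s$, let $A_s(k)$ be the number of lattice paths with unit East steps $(1,0)$ and unit North steps $(0,1)$, starting at $(0,0)$, staying strictly below the line $y=\frac ac x+\frac kc$ (i.e. every lattice point $(x,y)$ of the path satisfies $y<\frac ac x+\frac kc$), and ending at $(x_s,y_s)$ given by $$x_s=cs-r_a,\qquad y_s=as+r_c-1.$$ The numbers $x_s,y_s$ are non-negative for $s\ge S_0:=\max\left(\lceil r_a/c\rceil,\lceil -r_c/a\rceil\right)$, and for all integers $s\ge S_0$, $$\sum_{k=1}^{b}A_s(k)=\frac{b}{(a+c)s+(r_c-r_a)}\binom{(a+c)s+(r_c-r_a)}{as+r_c}.$$ -}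

module Defs where

open import Data.Nat.Base as ℕ using (ℕ; zero; suc)
open import Data.Integer.Base as ℤ using (ℤ; +_; ∣_∣; 0ℤ; 1ℤ)
import Data.Integer.Properties as ℤ
open import Data.Rational.Base as ℚ using (ℚ; _/_; ceiling)
import Data.Rational.Properties as ℚ
open import Data.List.Base using (List; []; _∷_; _++_; map; filter; length)
open import Data.List.Membership.Propositional using (_∈_)
open import Data.List.Membership.Propositional.Properties
  using (∈-map⁺; ∈-map⁻; ∈-++⁺ˡ; ∈-++⁺ʳ; ∈-filter⁺; ∈-filter⁻)
import Data.List.Properties as List
open import Data.List.Relation.Unary.All using (All; []; all?)
open import Data.List.Relation.Unary.Any using (here)
open import Data.List.Relation.Unary.Unique.Propositional using (Unique; []; _∷_)
import Data.List.Relation.Unary.Unique.Propositional.Properties as Unique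
open import Data.Empty using (⊥)
open import Data.Product.Base using (∃; _×_; _,_; proj₂)
open import Data.Product.Properties using (≡-dec)
open import Function.Bundles using (_⇔_; mk⇔)
open import Relation.Binary.PropositionalEquality
  using (_≡_; refl; sym; trans; cong; subst)
open import Relation.Nullary using (Dec)
open import Relation.Nullary.Decidable using (_×-dec_)

Point : Set
Point = ℤ × ℤ

origin : Point
origin = 0ℤ , 0ℤ

data Step : Set where
  E N : Step

move : Point → Step → Point
move (x , y) E = x ℤ.+ 1ℤ , y
move (x , y) N = x , y ℤ.+ 1ℤ

-- A path is given by its starting point and its word of steps.

vertices : Point → List Step → List Point
vertices p []      = p ∷ []
vertices p (s ∷ w) = p ∷ vertices (move p s) w

endpoint : Point → List Step → Point
endpoint p []      = p
endpoint p (s ∷ w) = endpoint (move p s) w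

module _ (a c k : ℕ) .{{_ : ℕ.NonZero c}} where

  StrictlyBelow : Point → Set
  StrictlyBelow (x , y) = y / 1 ℚ.< (+ a / c) ℚ.* (x / 1) ℚ.+ (+ k / c)

  strictlyBelow? : ∀ p → Dec (StrictlyBelow p)
  strictlyBelow? (x , y) = y / 1 ℚ.<? (+ a / c) ℚ.* (x / 1) ℚ.+ (+ k / c)

  IsPathTo : Point → List Step → Set
  IsPathTo q w = endpoint origin w ≡ q × All StrictlyBelow (vertices origin w)

  isPathTo? : ∀ q w → Dec (IsPathTo q w)
  isPathTo? q w =
    ≡-dec ℤ._≟_ ℤ._≟_ (endpoint origin w) q
      ×-dec all? strictlyBelow? (vertices origin w)

words : ℕ → List (List Step)
words zero    = [] ∷ []
words (suc n) = map (E ∷_) (words n) ++ map (N ∷_) (words n)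

-- A word ending at (x , y) has length x + y, so searching the words of length
-- ∣ x + y ∣ finds every path, each exactly once: see ∈-paths and paths-unique.
-- If x or y is negative, no word passes the test and the list is empty.

paths : (a c k : ℕ) .{{_ : ℕ.NonZero c}} → Point → List (List Step)
paths a c k (x , y) = filter (isPathTo? a c k (x , y)) (words ∣ x ℤ.+ y ∣)

xEnd : (c : ℕ) (ra s : ℤ) → ℤ
xEnd c ra s = + c ℤ.* s ℤ.- ra

yEnd : (a : ℕ) (rc s : ℤ) → ℤ
yEnd a rc s = + a ℤ.* s ℤ.+ rc ℤ.- 1ℤ

A : (a c : ℕ) .{{_ : ℕ.NonZero c}} (ra rc s : ℤ) (k : ℕ) → ℕ
A a c ra rc s k = length (paths a c k (xEnd c ra s , yEnd a rc s))

S₀ : (a c : ℕ) .{{_ : ℕ.NonZero a}} .{{_ : ℕ.NonZero c}} (ra rc : ℤ) → ℤ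
S₀ a c ra rc = ceiling (ra / c) ℤ.⊔ ceiling ((ℤ.- rc) / a)

private
  coordSum : Point → ℤ
  coordSum (x , y) = x ℤ.+ y

  move-sum : ∀ p s → coordSum (move p s) ≡ coordSum p ℤ.+ 1ℤ
  move-sum (x , y) E =
    trans (ℤ.+-assoc x 1ℤ y)
      (trans (cong (λ z → x ℤ.+ z) (ℤ.+-comm 1ℤ y)) (sym (ℤ.+-assoc x y 1ℤ)))
  move-sum (x , y) N = sym (ℤ.+-assoc x y 1ℤ)

  endpoint-sum : ∀ p w → coordSum (endpoint p w) ≡ coordSum p ℤ.+ + length w
  endpoint-sum p []      = sym (ℤ.+-identityʳ _)
  endpoint-sum p (s ∷ w) =
    trans (endpoint-sum (move p s) w)
      (trans (cong (λ z → z ℤ.+ + length w) (move-sum p s))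
             (ℤ.+-assoc (coordSum p) 1ℤ (+ length w)))

  ∈-words : ∀ w → w ∈ words (length w)
  ∈-words []      = here refl
  ∈-words (E ∷ w) = ∈-++⁺ˡ (∈-map⁺ (E ∷_) (∈-words w))
  ∈-words (N ∷ w) = ∈-++⁺ʳ (map (E ∷_) (words (length w))) (∈-map⁺ (N ∷_) (∈-words w))

  words-unique : ∀ n → Unique (words n)
  words-unique zero    = [] ∷ []
  words-unique (suc n) =
    Unique.++⁺ (Unique.map⁺ List.∷-injectiveʳ (words-unique n))
               (Unique.map⁺ List.∷-injectiveʳ (words-unique n))
               λ (p , q) → disjoint (∈-map⁻ (E ∷_) p) (∈-map⁻ (N ∷_) q)
    where
    disjoint : ∀ {v : List Step} →
      ∃ (λ u → u ∈ words n × v ≡ E ∷ u) → ∃ (λ u → u ∈ words n × v ≡ N ∷ u) → ⊥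
    disjoint (_ , _ , refl) (_ , _ , ())

∈-paths : ∀ a c k .{{_ : ℕ.NonZero c}} q w → w ∈ paths a c k q ⇔ IsPathTo a c k q w
∈-paths a c k q w = mk⇔
  (λ w∈ → proj₂ (∈-filter⁻ (isPathTo? a c k q) {xs = words ∣ coordSum q ∣} w∈))
  (λ path → ∈-filter⁺ (isPathTo? a c k q)
    (subst (λ n → w ∈ words n) (length≡ path) (∈-words w)) path)
  where
  length≡ : IsPathTo a c k q w → length w ≡ ∣ coordSum q ∣
  length≡ (end≡q , _) = cong ∣_∣
    (trans (sym (ℤ.+-identityˡ (+ length w)))
      (trans (sym (endpoint-sum origin w)) (cong coordSum end≡q)))

paths-unique : ∀ a c k .{{_ : ℕ.NonZero c}} q → Unique (paths a c k q)
paths-unique a c k q =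
  Unique.filter⁺ (isPathTo? a c k q) (words-unique ∣ coordSum q ∣)

{-# OPTIONS --safe #-}

-- Give (x , y) the height h = c y - a x, so that the endpoint followed by one North step has
-- height b. A path w with maximum height M lies strictly below line k exactly when M < k,
-- so the sum of the A_s(k) counts w with multiplicity max(0, b - M). Put an N before w and
-- continue N w periodically: that multiplicity is the amount by which the initial N raises
-- the running maximum of the periodic path. Over a full period the running maximum increases by
-- b, so the n = x + y + 1 rotations of any word with m = y + 1 norths contribute b in
-- total (a weighted cycle lemma). Rotation permutes the words, hence n times the sum is b (n C m).

module Submission where

open import Defs
open import Data.Nat.Base as ℕ using (ℕ; zero; suc; _+_; _*_; _∸_; _⊔_; _≤_; _<_; z≤n; s≤s)
import Data.Nat.Properties as ℕ
open import Data.Nat.Divisibility using (_∣_)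
open import Data.Nat.GCD using (gcd)
open import Data.Nat.Combinatorics using (_C_; nCk+nC[k+1]≡[n+1]C[k+1])
open import Data.Nat.ListAction using (sum)
open import Data.Nat.Tactic.RingSolver using (solve-∀)
import Data.Integer.Tactic.RingSolver as ℤ-Solver
open import Data.Integer.Base as ℤ using (ℤ; ∣_∣; 0ℤ; 1ℤ)
import Data.Integer.DivMod as ℤ
import Data.Integer.Properties as ℤ
open import Data.Rational.Base as ℚ using (_/_; ceiling; ↥_; ↧_)
import Data.Rational.Properties as ℚ
open import Data.Rational.Unnormalised.Base as ℚᵘ using (mkℚᵘ; *≡*; *<*)
import Data.Rational.Unnormalised.Properties as ℚᵘ
open import Data.Bool.Base using (true; false; if_then_else_)
open import Data.List.Base using (List; []; _∷_; _++_; _∷ʳ_; map; filter; length; applyUpTo)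
import Data.List.Properties as List
open import Data.List.Relation.Unary.All using (All; []; _∷_)
open import Data.Product.Base using (Σ; _×_; _,_; proj₁; proj₂; ∃-syntax)
open import Data.Sum.Base using (inj₁; inj₂)
open import Function.Base using (_∘_)
open import Function.Bundles using (_⇔_; mk⇔; Equivalence)
open import Relation.Binary.PropositionalEquality
  using (_≡_; refl; sym; trans; cong; cong₂; subst; subst₂; module ≡-Reasoning)
open import Relation.Nullary using (Dec; does; yes; no; contradiction)
open import Relation.Nullary.Decidable using (does-⇔; dec-true; dec-false; _×-dec_)
open import Relation.Unary using (Pred; Decidable)

-- Sums over all words of a given length.

𝟙 : ∀ {p} {P : Set p} → Dec P → ℕ
𝟙 P? = if does P? then 1 else 0

𝟙-cong : ∀ {p q} {P : Set p} {Q : Set q} → P ⇔ Q → (P? : Dec P) (Q? : Dec Q) → 𝟙 P? ≡ 𝟙 Q?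
𝟙-cong P⇔Q P? Q? = cong (if_then 1 else 0) (does-⇔ P⇔Q P? Q?)

-- Recursion on the first letter makes the split into words beginning with E and with N
-- definitional.
∑ : ℕ → (List Step → ℕ) → ℕ
∑ zero    f = f []
∑ (suc n) f = ∑ n (f ∘ (E ∷_)) + ∑ n (f ∘ (N ∷_))

∑-cong : ∀ n {f g} → (∀ w → length w ≡ n → f w ≡ g w) → ∑ n f ≡ ∑ n g
∑-cong zero    f≡g = f≡g [] refl
∑-cong (suc n) f≡g = cong₂ _+_ (∑-cong n λ w eq → f≡g (E ∷ w) (cong suc eq))
                               (∑-cong n λ w eq → f≡g (N ∷ w) (cong suc eq))

∑-zero : ∀ n → ∑ n (λ _ → 0) ≡ 0
∑-zero zero    = refl
∑-zero (suc n) = cong₂ _+_ (∑-zero n) (∑-zero n)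

+-interchange : ∀ p q r s → (p + q) + (r + s) ≡ (p + r) + (q + s)
+-interchange = solve-∀

∑-+ : ∀ n f g → ∑ n (λ w → f w + g w) ≡ ∑ n f + ∑ n g
∑-+ zero    f g = refl
∑-+ (suc n) f g = trans
  (cong₂ _+_ (∑-+ n (f ∘ (E ∷_)) (g ∘ (E ∷_))) (∑-+ n (f ∘ (N ∷_)) (g ∘ (N ∷_))))
  (+-interchange (∑ n (f ∘ (E ∷_))) _ _ _)

∑-*ʳ : ∀ n f k → ∑ n (λ w → f w * k) ≡ ∑ n f * k
∑-*ʳ zero    f k = refl
∑-*ʳ (suc n) f k = trans (cong₂ _+_ (∑-*ʳ n (f ∘ (E ∷_)) k) (∑-*ʳ n (f ∘ (N ∷_)) k))
                         (sym (ℕ.*-distribʳ-+ k (∑ n (f ∘ (E ∷_))) _))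

∑-sum : ∀ n b (f : ℕ → List Step → ℕ) →
  sum (applyUpTo (λ i → ∑ n (f i)) b) ≡ ∑ n (λ w → sum (applyUpTo (λ i → f i w) b))
∑-sum n zero    f = sym (∑-zero n)
∑-sum n (suc b) f = trans (cong (_ +_) (∑-sum n b (f ∘ suc))) (sym (∑-+ n (f 0) _))

length-filter-map : ∀ {p} {A B : Set} {P : Pred B p} (P? : Decidable P) (f : A → B) xs →
  length (filter P? (map f xs)) ≡ length (filter (P? ∘ f) xs)
length-filter-map P? f []       = refl
length-filter-map P? f (x ∷ xs) with does (P? (f x))
... | true  = cong suc (length-filter-map P? f xs)
... | false = length-filter-map P? f xs

length-filter-words : ∀ {p} {P : Pred (List Step) p} (P? : Decidable P) n →
  length (filter P? (words n)) ≡ ∑ n (𝟙 ∘ P?)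
length-filter-words P? zero with does (P? [])
... | true  = refl
... | false = refl
length-filter-words P? (suc n) = begin
  length (filter P? (Es ++ Ns))                         ≡⟨ cong length (List.filter-++ P? Es Ns) ⟩
  length (filter P? Es ++ filter P? Ns)                 ≡⟨ List.length-++ (filter P? Es) ⟩
  length (filter P? Es) + length (filter P? Ns)         ≡⟨ cong₂ _+_ (branch E) (branch N) ⟩
  ∑ (suc n) (𝟙 ∘ P?)                                    ∎
  where
  open ≡-Reasoning
  Es = map (E ∷_) (words n)
  Ns = map (N ∷_) (words n)
  branch : ∀ s → length (filter P? (map (s ∷_) (words n))) ≡ ∑ n (𝟙 ∘ P? ∘ (s ∷_))
  branch s = trans (length-filter-map P? (s ∷_) (words n)) (length-filter-words (P? ∘ (s ∷_)) n)

-- Rotations of words and sums along orbits.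

rotate : List Step → List Step
rotate []      = []
rotate (s ∷ w) = w ∷ʳ s

-- The right side is the sum of `f ∘ rotate`, so this is invariance under rotation.
∑-∷ʳ : ∀ n f → ∑ (suc n) f ≡ ∑ n (λ w → f (w ∷ʳ E)) + ∑ n (λ w → f (w ∷ʳ N))
∑-∷ʳ zero    f = refl
∑-∷ʳ (suc n) f = trans (cong₂ _+_ (∑-∷ʳ n (f ∘ (E ∷_))) (∑-∷ʳ n (f ∘ (N ∷_))))
                       (+-interchange (∑ n (λ w → f (E ∷ w ∷ʳ E))) _ _ _)

∑-rotate : ∀ n f → ∑ n (f ∘ rotate) ≡ ∑ n f
∑-rotate zero    f = refl
∑-rotate (suc n) f = sym (∑-∷ʳ n f)

orbitSum : (List Step → ℕ) → ℕ → List Step → ℕ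
orbitSum f zero    w = 0
orbitSum f (suc j) w = f w + orbitSum f j (rotate w)

∑-orbitSum : ∀ n f j → ∑ n (orbitSum f j) ≡ j * ∑ n f
∑-orbitSum n f zero    = ∑-zero n
∑-orbitSum n f (suc j) = trans (∑-+ n f (orbitSum f j ∘ rotate))
  (cong (∑ n f +_) (trans (∑-rotate n (orbitSum f j)) (∑-orbitSum n f j)))

-- Counting steps, and the binomial coefficient.

easts norths : List Step → ℕ
easts []      = 0
easts (E ∷ w) = suc (easts w)
easts (N ∷ w) = easts w
norths []      = 0
norths (E ∷ w) = norths w
norths (N ∷ w) = suc (norths w)

easts+norths≡length : ∀ w → easts w + norths w ≡ length w
easts+norths≡length []      = refl
easts+norths≡length (E ∷ w) = cong suc (easts+norths≡length w)
easts+norths≡length (N ∷ w) = trans (ℕ.+-suc (easts w) (norths w)) (cong suc (easts+norths≡length w))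

easts-∷ʳ : ∀ w s → easts (w ∷ʳ s) ≡ easts (s ∷ w)
easts-∷ʳ []      s = refl
easts-∷ʳ (E ∷ w) E = cong suc (easts-∷ʳ w E)
easts-∷ʳ (E ∷ w) N = cong suc (easts-∷ʳ w N)
easts-∷ʳ (N ∷ w) E = easts-∷ʳ w E
easts-∷ʳ (N ∷ w) N = easts-∷ʳ w N

norths-∷ʳ : ∀ w s → norths (w ∷ʳ s) ≡ norths (s ∷ w)
norths-∷ʳ []      s = refl
norths-∷ʳ (E ∷ w) E = norths-∷ʳ w E
norths-∷ʳ (E ∷ w) N = norths-∷ʳ w N
norths-∷ʳ (N ∷ w) E = cong suc (norths-∷ʳ w E)
norths-∷ʳ (N ∷ w) N = cong suc (norths-∷ʳ w N)

norths-rotate : ∀ w → norths (rotate w) ≡ norths w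
norths-rotate []      = refl
norths-rotate (s ∷ w) = norths-∷ʳ w s

-- Pascal's rule on the first letter: E leaves `m` norths to place, N one fewer.
∑-norths≡C : ∀ n m → ∑ n (λ w → 𝟙 (norths w ℕ.≟ m)) ≡ n C m
∑-norths≡C zero    zero    = refl
∑-norths≡C zero    (suc m) = refl
∑-norths≡C (suc n) zero    = cong₂ _+_ (∑-norths≡C n 0) (∑-zero n)
∑-norths≡C (suc n) (suc m) = begin
  ∑ n (λ w → 𝟙 (norths w ℕ.≟ suc m)) + ∑ n (λ w → 𝟙 (norths w ℕ.≟ m))
    ≡⟨ cong₂ _+_ (∑-norths≡C n (suc m)) (∑-norths≡C n m) ⟩
  n C suc m + n C m  ≡⟨ ℕ.+-comm (n C suc m) (n C m) ⟩
  n C m + n C suc m  ≡⟨ nCk+nC[k+1]≡[n+1]C[k+1] n m ⟩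
  suc n C suc m      ∎
  where open ≡-Reasoning

-- The running maximum of the height along a path.

m+[n∸m]≡n+[m∸n] : ∀ m n → m + (n ∸ m) ≡ n + (m ∸ n)
m+[n∸m]≡n+[m∸n] zero    n       = trans (sym (ℕ.+-identityʳ n)) (cong (n +_) (sym (ℕ.0∸n≡0 n)))
m+[n∸m]≡n+[m∸n] (suc m) zero    = ℕ.+-identityʳ (suc m)
m+[n∸m]≡n+[m∸n] (suc m) (suc n) = cong suc (m+[n∸m]≡n+[m∸n] m n)

module _ (a c : ℕ) where

  -- The height of (x , y) is c y - a x, and the gap of a point of a path is how far
  -- its height lies below the maximum height reached so far.

  step : Step → ℕ → ℕ
  step E g = g + a
  step N g = g ∸ c

  -- A North step raises the height by `c`: it first closes the gap, and only the excess raises the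
  -- maximum.
  gain : Step → ℕ → ℕ
  gain E g = 0
  gain N g = c ∸ g

  gap : List Step → ℕ → ℕ
  gap []      g = g
  gap (s ∷ w) g = gap w (step s g)

  rise : List Step → ℕ → ℕ
  rise []      g = 0
  rise (s ∷ w) g = gain s g + rise w (step s g)

  gap-++ : ∀ v w g → gap (v ++ w) g ≡ gap w (gap v g)
  gap-++ []      w g = refl
  gap-++ (s ∷ v) w g = gap-++ v w (step s g)

  -- Height is maximum minus gap at both ends and changes by `c * norths w - a * easts w` in
  -- between.
  rise-gap : ∀ w g → rise w g + g + a * easts w ≡ gap w g + c * norths w
  rise-gap []      g = trans (cong (g +_) (ℕ.*-zeroʳ a)) (cong (g +_) (sym (ℕ.*-zeroʳ c)))
  rise-gap (E ∷ w) g = trans (shift (rise w (g + a)) g a (easts w)) (rise-gap w (g + a))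
    where
    shift : ∀ r g a e → r + g + a * suc e ≡ r + (g + a) + a * e
    shift = solve-∀
  rise-gap (N ∷ w) g = begin
    c ∸ g + r + g + a * e        ≡⟨ rearrange (c ∸ g) r g (a * e) ⟩
    (g + (c ∸ g)) + (r + a * e)  ≡⟨ cong (_+ (r + a * e)) (m+[n∸m]≡n+[m∸n] g c) ⟩
    (c + (g ∸ c)) + (r + a * e)  ≡⟨ rearrange′ c (g ∸ c) r (a * e) ⟩
    c + (r + (g ∸ c) + a * e)    ≡⟨ cong (c +_) (rise-gap w (g ∸ c)) ⟩
    c + (gap w (g ∸ c) + c * n)  ≡⟨ rearrange″ c (gap w (g ∸ c)) n ⟩
    gap w (g ∸ c) + c * suc n    ∎
    where
    open ≡-Reasoning
    e = easts w
    n = norths w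
    r = rise w (g ∸ c)
    rearrange : ∀ p r g z → p + r + g + z ≡ (g + p) + (r + z)
    rearrange = solve-∀
    rearrange′ : ∀ c p r z → (c + p) + (r + z) ≡ c + (r + p + z)
    rearrange′ = solve-∀
    rearrange″ : ∀ c p n → c + (p + c * n) ≡ p + c * suc n
    rearrange″ = solve-∀

  -- The final maximum is either attained on `w`, where the initial gap no longer matters, or still
  -- the earlier one, and then the gap has changed by the net descent. The larger maximum gives the
  -- larger gap.
  gap-⊔ : ∀ w g → gap w g ≡ gap w 0 ⊔ (g + a * easts w ∸ c * norths w)
  gap-⊔ []      g = sym (cong₂ _∸_ (trans (cong (g +_) (ℕ.*-zeroʳ a)) (ℕ.+-identityʳ g)) (ℕ.*-zeroʳ c))
  gap-⊔ (E ∷ w) g = begin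
    gap w (g + a)                                        ≡⟨ gap-⊔ w (g + a) ⟩
    -- A dominated term is inserted so that the induction hypothesis at `a` folds into
    -- `gap (E ∷ w) 0`.
    gap w 0 ⊔ (g + a + z ∸ t)                            ≡⟨ cong (gap w 0 ⊔_) (ℕ.m≤n⇒m⊔n≡n smaller) ⟨
    gap w 0 ⊔ ((a + z ∸ t) ⊔ (g + a + z ∸ t))            ≡⟨ ℕ.⊔-assoc (gap w 0) _ _ ⟨
    (gap w 0 ⊔ (a + z ∸ t)) ⊔ (g + a + z ∸ t)            ≡⟨ cong₂ _⊔_ (sym (gap-⊔ w a)) (cong (_∸ t) shift) ⟩
    gap w a ⊔ (g + a * suc (easts w) ∸ t)                ∎
    where
    open ≡-Reasoning
    z = a * easts w
    t = c * norths w
    smaller : a + z ∸ t ≤ g + a + z ∸ t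
    smaller = ℕ.∸-monoˡ-≤ t (ℕ.+-monoˡ-≤ z (ℕ.m≤n+m a g))
    shift : g + a + z ≡ g + a * suc (easts w)
    shift = trans (ℕ.+-assoc g a z) (cong (g +_) (sym (ℕ.*-suc a (easts w))))
  gap-⊔ (N ∷ w) g rewrite ℕ.0∸n≡0 c | ℕ.*-suc c (norths w) with ℕ.≤-total c g
  ... | inj₁ c≤g = begin
    gap w (g ∸ c)                        ≡⟨ gap-⊔ w (g ∸ c) ⟩
    gap w 0 ⊔ (g ∸ c + z ∸ t)            ≡⟨ cong (λ x → gap w 0 ⊔ (x ∸ t)) (ℕ.+-∸-comm z c≤g) ⟨
    gap w 0 ⊔ (g + z ∸ c ∸ t)            ≡⟨ cong (gap w 0 ⊔_) (ℕ.∸-+-assoc (g + z) c t) ⟩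
    gap w 0 ⊔ (g + z ∸ (c + t))          ∎
    where
    open ≡-Reasoning
    z = a * easts w
    t = c * norths w
  -- Here the North step closes the gap, and the second term is absorbed.
  ... | inj₂ g≤c rewrite ℕ.m≤n⇒m∸n≡0 g≤c = sym (ℕ.m≥n⇒m⊔n≡m (begin
    g + z ∸ (c + t)        ≤⟨ ℕ.∸-monoˡ-≤ (c + t) (ℕ.+-monoˡ-≤ z g≤c) ⟩
    c + z ∸ (c + t)        ≡⟨ ℕ.[m+n]∸[m+o]≡n∸o c z t ⟩
    z ∸ t                  ≤⟨ ℕ.m≤n⊔m (gap w 0) (z ∸ t) ⟩
    gap w 0 ⊔ (z ∸ t)      ≡⟨ gap-⊔ w 0 ⟨
    gap w 0                ∎))
    where
    open ℕ.≤-Reasoning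
    z = a * easts w
    t = c * norths w

  -- Words of net ascent `b`, their periodic continuation, and the cycle lemma.

  Ascends : ℕ → List Step → Set
  Ascends b w = a * easts w + b ≡ c * norths w

  -- In `gap-⊔` the alternative to `gap w 0` is `gap w 0` lowered by the ascent `b`. So `gap w 0` is
  -- the gap at every period boundary.
  gap-stable : ∀ {b} w → Ascends b w → gap w (gap w 0) ≡ gap w 0
  gap-stable {b} w asc = trans (gap-⊔ w γ) (ℕ.m≥n⇒m⊔n≡m (begin
    γ + a * easts w ∸ c * norths w      ≡⟨ cong (γ + a * easts w ∸_) asc ⟨
    γ + a * easts w ∸ (a * easts w + b) ≡⟨ ℕ.∸-+-assoc (γ + a * easts w) (a * easts w) b ⟨
    γ + a * easts w ∸ a * easts w ∸ b   ≡⟨ cong (_∸ b) (ℕ.m+n∸n≡m γ (a * easts w)) ⟩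
    γ ∸ b                               ≤⟨ ℕ.m∸n≤m γ b ⟩
    γ                                   ∎))
    where
    open ℕ.≤-Reasoning
    γ = gap w 0

  -- With equal gaps at both ends of a period, maximum and height rise by the same amount.
  rise-stable : ∀ {b} w → Ascends b w → rise w (gap w 0) ≡ b
  rise-stable {b} w asc = ℕ.+-cancelʳ-≡ (γ + z) (rise w γ) b (begin
    rise w γ + (γ + z)      ≡⟨ ℕ.+-assoc (rise w γ) γ z ⟨
    rise w γ + γ + z        ≡⟨ rise-gap w γ ⟩
    gap w γ + c * norths w  ≡⟨ cong₂ _+_ (gap-stable w asc) (sym asc) ⟩
    γ + (z + b)             ≡⟨ rearrange γ z b ⟩
    b + (γ + z)             ∎)
    where
    open ≡-Reasoning
    γ = gap w 0
    z = a * easts w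
    rearrange : ∀ γ z b → γ + (z + b) ≡ b + (γ + z)
    rearrange = solve-∀

  Ascends-∷ʳ : ∀ {b} s w → Ascends b (s ∷ w) → Ascends b (w ∷ʳ s)
  Ascends-∷ʳ {b} s w = subst₂ (λ e n → a * e + b ≡ c * n) (sym (easts-∷ʳ w s)) (sym (norths-∷ʳ w s))

  -- Moving the period boundary past `s` advances the periodic gap by one step.
  gap-∷ʳ : ∀ {b} s w → Ascends b (s ∷ w) → gap (w ∷ʳ s) 0 ≡ step s (gap (s ∷ w) 0)
  gap-∷ʳ N w asc = trans (gap-++ w _ 0) (cong (λ x → gap w x ∸ c) (sym (ℕ.0∸n≡0 c)))
  -- A start with gap `a` also ends at `gap w 0`: as `E ∷ w` ascends, `w` recovers the initial drop.
  gap-∷ʳ {b} E w asc = trans (gap-++ w _ 0) (cong (_+ a) (sym (trans (gap-⊔ w a)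
    (trans (cong (gap w 0 ⊔_) (ℕ.m≤n⇒m∸n≡0 (begin
      a + a * easts w       ≡⟨ ℕ.*-suc a (easts w) ⟨
      a * suc (easts w)     ≤⟨ ℕ.m≤m+n _ b ⟩
      a * suc (easts w) + b ≡⟨ asc ⟩
      c * norths w          ∎))) (ℕ.⊔-identityʳ (gap w 0))))))
    where open ℕ.≤-Reasoning

  -- For an ascending word, `gap (s ∷ w) 0` is the gap before `s` in the periodic path, so this is
  -- what `s` adds to the maximum there.
  firstGain : List Step → ℕ
  firstGain []      = 0
  firstGain (s ∷ w) = gain s (gap (s ∷ w) 0)

  -- The gap after a full period is the gap before it, so the first gains of the
  -- rotations of w add up to the rise of one period of the bi-infinite periodic path.
  orbitSum-firstGain : ∀ {b} u v → Ascends b (u ++ v) →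
    orbitSum firstGain (length u) (u ++ v) ≡ rise u (gap (u ++ v) 0)
  orbitSum-firstGain []      v asc = refl
  orbitSum-firstGain (s ∷ u) v asc = cong (gain s (gap (s ∷ u ++ v) 0) +_) (begin
    orbitSum firstGain (length u) ((u ++ v) ∷ʳ s) ≡⟨ cong (orbitSum firstGain (length u)) assoc ⟩
    orbitSum firstGain (length u) (u ++ v ∷ʳ s)
      ≡⟨ orbitSum-firstGain u (v ∷ʳ s) (subst (Ascends _) assoc (Ascends-∷ʳ s (u ++ v) asc)) ⟩
    rise u (gap (u ++ v ∷ʳ s) 0)                  ≡⟨ cong (λ w → rise u (gap w 0)) assoc ⟨
    rise u (gap ((u ++ v) ∷ʳ s) 0)                ≡⟨ cong (rise u) (gap-∷ʳ s (u ++ v) asc) ⟩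
    rise u (step s (gap (s ∷ u ++ v) 0))          ∎)
    where
    open ≡-Reasoning
    assoc = List.++-assoc u v (s ∷ [])

  -- With `v` empty, `u` is a full period; in the induction `v` holds the letters already moved to
  -- the end.
  orbitSum-firstGain-length : ∀ {b} w → Ascends b w → orbitSum firstGain (length w) w ≡ b
  orbitSum-firstGain-length w asc =
    trans (subst (λ v → orbitSum firstGain (length w) v ≡ rise w (gap v 0)) (List.++-identityʳ w)
             (orbitSum-firstGain w [] (subst (Ascends _) (sym (List.++-identityʳ w)) asc)))
          (rise-stable w asc)

  orbitSum-𝟙 : ∀ m f j w →
    orbitSum (λ v → 𝟙 (norths v ℕ.≟ m) * f v) j w ≡ 𝟙 (norths w ℕ.≟ m) * orbitSum f j w
  orbitSum-𝟙 m f zero    w = sym (ℕ.*-zeroʳ (𝟙 (norths w ℕ.≟ m)))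
  orbitSum-𝟙 m f (suc j) w = trans
    (cong (_ +_) (trans (orbitSum-𝟙 m f j (rotate w))
      (cong (λ n → 𝟙 (n ℕ.≟ m) * orbitSum f j (rotate w)) (norths-rotate w))))
    (sym (ℕ.*-distribˡ-+ (𝟙 (norths w ℕ.≟ m)) (f w) _))

  -- The equation says that every word with `x` easts and `m` norths ascends by `b`, so its orbit
  -- sum is `b`; all other words of this length weigh 0.
  cycle-lemma : ∀ x m b → a * x + b ≡ c * m →
    (x + m) * ∑ (x + m) (λ w → 𝟙 (norths w ℕ.≟ m) * firstGain w) ≡ ((x + m) C m) * b
  cycle-lemma x m b eq = begin
    n * ∑ n f                                   ≡⟨ ∑-orbitSum n f n ⟨
    ∑ n (orbitSum f n)                          ≡⟨ ∑-cong n pointwise ⟩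
    ∑ n (λ w → 𝟙 (norths w ℕ.≟ m) * b)          ≡⟨ ∑-*ʳ n (λ w → 𝟙 (norths w ℕ.≟ m)) b ⟩
    ∑ n (λ w → 𝟙 (norths w ℕ.≟ m)) * b          ≡⟨ cong (_* b) (∑-norths≡C n m) ⟩
    (n C m) * b                                 ∎
    where
    open ≡-Reasoning
    n = x + m
    f : List Step → ℕ
    f w = 𝟙 (norths w ℕ.≟ m) * firstGain w
    pointwise : ∀ w → length w ≡ n → orbitSum f n w ≡ 𝟙 (norths w ℕ.≟ m) * b
    pointwise w len with orbitSum-𝟙 m firstGain n w | norths w ℕ.≟ m
    ... | fact | no norths≢m rewrite dec-false (norths w ℕ.≟ m) norths≢m = fact
    ... | fact | yes refl rewrite dec-true (norths w ℕ.≟ norths w) refl =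
      trans fact (cong (_+ 0) (trans (cong (λ k → orbitSum firstGain k w) (sym len))
        (orbitSum-firstGain-length w (trans (cong (λ e → a * e + b) easts≡x) eq))))
      where
      easts≡x : easts w ≡ x
      easts≡x = ℕ.+-cancelʳ-≡ (norths w) (easts w) x (trans (easts+norths≡length w) len)

-- Ceilings and rational comparisons reduced to integers.

ceiling≤⇒↥≤ : ∀ p i → ceiling p ℤ.≤ i → ↥ p ℤ.≤ i ℤ.* ↧ p
-- `ceiling p` unfolds to the negated floor of `- p`, so the negated claim is a bound for integer
-- division.
ceiling≤⇒↥≤ p@record{} i ⌈p⌉≤i = ℤ.neg-cancel-≤ (begin
  ℤ.- (i ℤ.* ↧ p)                         ≡⟨ ℤ.neg-distribˡ-* i (↧ p) ⟩
  ℤ.- i ℤ.* ↧ p                           ≤⟨ ℤ.*-monoʳ-≤-nonNeg (↧ p) -i≤⌊-p⌋ ⟩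
  ℚ.floor (ℚ.- p) ℤ.* ↧ p                 ≡⟨ cong (ℚ.floor (ℚ.- p) ℤ.*_) (ℚ.↧-neg p) ⟨
  ℚ.floor (ℚ.- p) ℤ.* ↧ (ℚ.- p)           ≤⟨ floor*↧≤↥ (ℚ.- p) ⟩
  ↥ (ℚ.- p)                               ≡⟨ ℚ.↥-neg p ⟩
  ℤ.- (↥ p)                               ∎)
  where
  open ℤ.≤-Reasoning
  floor*↧≤↥ : ∀ q → ℚ.floor q ℤ.* ↧ q ℤ.≤ ↥ q
  floor*↧≤↥ q@record{} = ℤ.[n/d]*d≤n (↥ q) (↧ q)
  -i≤⌊-p⌋ : ℤ.- i ℤ.≤ ℚ.floor (ℚ.- p)
  -i≤⌊-p⌋ = subst (ℤ.- i ℤ.≤_) (ℤ.neg-involutive _) (ℤ.neg-mono-≤ ⌈p⌉≤i)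

-- `i / n` is in lowest terms, so the bound is multiplied by the gcd divided out.
ceiling[i/n]≤j⇒i≤j*n : ∀ i n j .{{_ : ℕ.NonZero n}} → ceiling (i / n) ℤ.≤ j → i ℤ.≤ j ℤ.* ℤ.+ n
ceiling[i/n]≤j⇒i≤j*n i n j le = subst₂ ℤ._≤_ (ℚ.↥-/ i n)
  (trans (ℤ.*-assoc j (↧ (i / n)) _) (cong (j ℤ.*_) (ℚ.↧-/ i n)))
  (ℤ.*-monoʳ-≤-nonNeg _ (ceiling≤⇒↥≤ (i / n) j le))

toℚᵘ-/ : ∀ i n .{{_ : ℕ.NonZero n}} → ℚ.toℚᵘ (i / n) ℚᵘ.≃ i ℚᵘ./ n
toℚᵘ-/ i (suc n) = ℚ.toℚᵘ-fromℚᵘ (mkℚᵘ i n)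

/1≡/*/1 : ∀ n s b t .{{_ : ℕ.NonZero n}} → n * s ≡ t * b →
  ℤ.+ s / 1 ≡ (ℤ.+ b / n) ℚ.* (ℤ.+ t / 1)
/1≡/*/1 n@(suc _) s b t eq = ℚ.toℚᵘ-injective (begin
  ℚ.toℚᵘ (ℤ.+ s / 1)                                   ≈⟨ toℚᵘ-/ (ℤ.+ s) 1 ⟩
  ℤ.+ s ℚᵘ./ 1                                         ≈⟨ *≡* cross ⟩
  (ℤ.+ b ℚᵘ./ n) ℚᵘ.* (ℤ.+ t ℚᵘ./ 1)                   ≈⟨ ℚᵘ.*-cong (toℚᵘ-/ (ℤ.+ b) n) (toℚᵘ-/ (ℤ.+ t) 1) ⟨
  ℚ.toℚᵘ (ℤ.+ b / n) ℚᵘ.* ℚ.toℚᵘ (ℤ.+ t / 1)           ≈⟨ ℚ.toℚᵘ-homo-* (ℤ.+ b / n) (ℤ.+ t / 1) ⟨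
  ℚ.toℚᵘ ((ℤ.+ b / n) ℚ.* (ℤ.+ t / 1))                 ∎)
  where
  open ℚᵘ.≃-Reasoning
  cross : ℤ.+ s ℤ.* ℤ.+ (n * 1) ≡ ℤ.+ b ℤ.* ℤ.+ t ℤ.* 1ℤ
  cross = trans (sym (ℤ.pos-* s (n * 1))) (trans (cong ℤ.+_
    (trans (cong (s *_) (ℕ.*-identityʳ n)) (trans (ℕ.*-comm s n) (trans eq (ℕ.*-comm t b)))))
    (trans (ℤ.pos-* b t) (sym (ℤ.*-identityʳ _))))

-- Cross multiplication of the unnormalised sides leaves a common factor `c` to cancel, since adding
-- the fractions multiplies the denominators `c * 1` and `c`.
strictlyBelow⇔ : ∀ a c k .{{_ : ℕ.NonZero c}} x y →
  StrictlyBelow a c k (ℤ.+ x , ℤ.+ y) ⇔ c * y < a * x + k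
strictlyBelow⇔ a c@(suc _) k x y = mk⇔ to from
  where
  lhs≃ : ℚ.toℚᵘ (ℤ.+ y / 1) ℚᵘ.≃ ℤ.+ y ℚᵘ./ 1
  lhs≃ = toℚᵘ-/ (ℤ.+ y) 1
  lineᵘ = (ℤ.+ a ℚᵘ./ c) ℚᵘ.* (ℤ.+ x ℚᵘ./ 1) ℚᵘ.+ (ℤ.+ k ℚᵘ./ c)
  rhs≃ : ℚ.toℚᵘ ((ℤ.+ a / c) ℚ.* (ℤ.+ x / 1) ℚ.+ (ℤ.+ k / c)) ℚᵘ.≃ lineᵘ
  rhs≃ = ℚᵘ.≃-trans (ℚ.toℚᵘ-homo-+ ((ℤ.+ a / c) ℚ.* (ℤ.+ x / 1)) (ℤ.+ k / c))
    (ℚᵘ.+-cong (ℚᵘ.≃-trans (ℚ.toℚᵘ-homo-* (ℤ.+ a / c) (ℤ.+ x / 1))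
                 (ℚᵘ.*-cong (toℚᵘ-/ (ℤ.+ a) c) (toℚᵘ-/ (ℤ.+ x) 1)))
               (toℚᵘ-/ (ℤ.+ k) c))
  cross-lhs : ℤ.+ y ℤ.* ℤ.+ (c * 1 * c) ≡ ℤ.+ (c * y) ℤ.* ℤ.+ c
  cross-lhs = trans (sym (ℤ.pos-* y _)) (trans (cong ℤ.+_ (rearrange y c)) (ℤ.pos-* (c * y) c))
    where
    rearrange : ∀ y c → y * (c * 1 * c) ≡ c * y * c
    rearrange = solve-∀
  cross-rhs : (ℤ.+ a ℤ.* ℤ.+ x ℤ.* ℤ.+ c ℤ.+ ℤ.+ k ℤ.* ℤ.+ (c * 1)) ℤ.* 1ℤ ≡ ℤ.+ (a * x + k) ℤ.* ℤ.+ c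
  cross-rhs = trans (ℤ.*-identityʳ _) (trans (cong₂ ℤ._+_
      (cong (ℤ._* ℤ.+ c) (sym (ℤ.pos-* a x)))
      (cong (λ z → ℤ.+ k ℤ.* ℤ.+ z) (ℕ.*-identityʳ c)))
    (sym (ℤ.*-distribʳ-+ (ℤ.+ c) (ℤ.+ (a * x)) (ℤ.+ k))))
  to : StrictlyBelow a c k (ℤ.+ x , ℤ.+ y) → c * y < a * x + k
  to below with ℚᵘ.<-respˡ-≃ lhs≃ (ℚᵘ.<-respʳ-≃ rhs≃ (ℚ.toℚᵘ-mono-< below))
  ... | *<* lt = ℤ.drop‿+<+ (ℤ.*-cancelʳ-<-nonNeg (ℤ.+ c) (subst₂ ℤ._<_ cross-lhs cross-rhs lt))
  from : c * y < a * x + k → StrictlyBelow a c k (ℤ.+ x , ℤ.+ y)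
  from lt = ℚ.toℚᵘ-cancel-< (ℚᵘ.<-respˡ-≃ (ℚᵘ.≃-sym lhs≃) (ℚᵘ.<-respʳ-≃ (ℚᵘ.≃-sym rhs≃)
    (*<* (subst₂ ℤ._<_ (sym cross-lhs) (sym cross-rhs) (ℤ.*-monoʳ-<-pos (ℤ.+ c) (ℤ.+<+ lt))))))

-- Lattice paths below a line, in terms of their maximum height.

endpoint-counts : ∀ x y w →
  endpoint (ℤ.+ x , ℤ.+ y) w ≡ (ℤ.+ (x + easts w) , ℤ.+ (y + norths w))
endpoint-counts x y [] = cong₂ (λ i j → ℤ.+ i , ℤ.+ j) (sym (ℕ.+-identityʳ x)) (sym (ℕ.+-identityʳ y))
endpoint-counts x y (E ∷ w) = trans (endpoint-counts (x + 1) y w)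
  (cong (λ i → ℤ.+ i , ℤ.+ (y + norths w)) (ℕ.+-assoc x 1 (easts w)))
endpoint-counts x y (N ∷ w) = trans (endpoint-counts x (y + 1) w)
  (cong (λ j → ℤ.+ (x + easts w) , ℤ.+ j) (ℕ.+-assoc y 1 (norths w)))

All-vertices-head : ∀ {P : Point → Set} p w → All P (vertices p w) → P p
All-vertices-head p []      (px ∷ _) = px
All-vertices-head p (s ∷ w) (px ∷ _) = px

module _ (a c k : ℕ) .{{_ : ℕ.NonZero c}} where

  -- Here m is the maximum height so far, so c y + g ≡ m + a x says that g is the gap at (x , y).

  private
    invariant-E : ∀ {x y g m} → c * y + g ≡ m + a * x → c * y + (g + a) ≡ m + 0 + a * (x + 1)
    invariant-E {x} {y} {g} {m} eq = begin
      c * y + (g + a)        ≡⟨ ℕ.+-assoc (c * y) g a ⟨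
      c * y + g + a          ≡⟨ cong (_+ a) eq ⟩
      m + a * x + a          ≡⟨ rearrange m a x ⟩
      m + 0 + a * (x + 1)    ∎
      where
      open ≡-Reasoning
      rearrange : ∀ m a x → m + a * x + a ≡ m + 0 + a * (x + 1)
      rearrange = solve-∀

    invariant-N : ∀ {x y g m} → c * y + g ≡ m + a * x →
      c * (y + 1) + (g ∸ c) ≡ m + (c ∸ g) + a * x
    invariant-N {x} {y} {g} {m} eq = begin
      c * (y + 1) + (g ∸ c)      ≡⟨ rearrange c y (g ∸ c) ⟩
      c * y + (c + (g ∸ c))      ≡⟨ cong (c * y +_) (m+[n∸m]≡n+[m∸n] c g) ⟩
      c * y + (g + (c ∸ g))      ≡⟨ ℕ.+-assoc (c * y) g (c ∸ g) ⟨
      c * y + g + (c ∸ g)        ≡⟨ cong (_+ (c ∸ g)) eq ⟩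
      m + a * x + (c ∸ g)        ≡⟨ rearrange′ m (a * x) (c ∸ g) ⟩
      m + (c ∸ g) + a * x        ∎
      where
      open ≡-Reasoning
      rearrange : ∀ c y d → c * (y + 1) + d ≡ c * y + (c + d)
      rearrange = solve-∀
      rearrange′ : ∀ m z d → m + z + d ≡ m + d + z
      rearrange′ = solve-∀

    -- If `c ≤ g` the maximum stays; otherwise it becomes the height of the new vertex, which is
    -- below the line.
    max<-N : ∀ {x y g m} → c * y + g ≡ m + a * x → m < k → c * (y + 1) < a * x + k → m + (c ∸ g) < k
    max<-N {x} {y} {g} {m} eq m<k below with ℕ.≤-total c g
    ... | inj₁ c≤g rewrite ℕ.m≤n⇒m∸n≡0 c≤g | ℕ.+-identityʳ m = m<k
    ... | inj₂ g≤c = ℕ.+-cancelˡ-< (a * x) _ _ (begin-strict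
      a * x + (m + (c ∸ g))    ≡⟨ ℕ.+-comm (a * x) _ ⟩
      m + (c ∸ g) + a * x      ≡⟨ invariant-N {x} {y} {g} {m} eq ⟨
      c * (y + 1) + (g ∸ c)    ≡⟨ cong (c * (y + 1) +_) (ℕ.m≤n⇒m∸n≡0 g≤c) ⟩
      c * (y + 1) + 0          ≡⟨ ℕ.+-identityʳ _ ⟩
      c * (y + 1)              <⟨ below ⟩
      a * x + k                ∎)
      where open ℕ.≤-Reasoning

    below-of-max : ∀ {x y g m} → c * y + g ≡ m + a * x → m < k → c * y < a * x + k
    below-of-max {x} {y} {g} {m} eq m<k = begin-strict
      c * y        ≤⟨ ℕ.m≤m+n (c * y) g ⟩
      c * y + g    ≡⟨ eq ⟩
      m + a * x    <⟨ ℕ.+-monoˡ-< (a * x) m<k ⟩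
      k + a * x    ≡⟨ ℕ.+-comm k (a * x) ⟩
      a * x + k    ∎
      where open ℕ.≤-Reasoning

  below⇒rise< : ∀ w {x y g m} → c * y + g ≡ m + a * x → m < k →
    All (StrictlyBelow a c k) (vertices (ℤ.+ x , ℤ.+ y) w) → m + rise a c w g < k
  below⇒rise< []      {m = m} eq m<k below = subst (_< k) (sym (ℕ.+-identityʳ m)) m<k
  below⇒rise< (E ∷ w) {x} {y} {g} {m} eq m<k (_ ∷ below) = subst (_< k) (ℕ.+-assoc m 0 _)
    (below⇒rise< w (invariant-E {x} {y} {g} {m} eq) (subst (_< k) (sym (ℕ.+-identityʳ m)) m<k) below)
  below⇒rise< (N ∷ w) {x} {y} {g} {m} eq m<k (_ ∷ below) = subst (_< k) (ℕ.+-assoc m (c ∸ g) _)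
    (below⇒rise< w (invariant-N {x} {y} {g} {m} eq)
      (max<-N {x} {y} {g} {m} eq m<k
        (Equivalence.to (strictlyBelow⇔ a c k x (y + 1)) (All-vertices-head _ w below)))
      below)

  -- No height exceeds the running maximum, and that never exceeds its final value.
  rise<⇒below : ∀ w {x y g m} → c * y + g ≡ m + a * x → m + rise a c w g < k →
    All (StrictlyBelow a c k) (vertices (ℤ.+ x , ℤ.+ y) w)
  rise<⇒below w {x} {y} {g} {m} eq lt = go w
    (Equivalence.from (strictlyBelow⇔ a c k x y)
      (below-of-max {x} {y} {g} {m} eq (ℕ.≤-<-trans (ℕ.m≤m+n m _) lt))) lt
    where
    go : ∀ w → StrictlyBelow a c k (ℤ.+ x , ℤ.+ y) → m + rise a c w g < k →
      All (StrictlyBelow a c k) (vertices (ℤ.+ x , ℤ.+ y) w)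
    go []      here lt = here ∷ []
    go (E ∷ w) here lt = here ∷ rise<⇒below w (invariant-E {x} {y} {g} {m} eq)
      (subst (_< k) (sym (ℕ.+-assoc m 0 _)) lt)
    go (N ∷ w) here lt = here ∷ rise<⇒below w (invariant-N {x} {y} {g} {m} eq)
      (subst (_< k) (sym (ℕ.+-assoc m (c ∸ g) _)) lt)

  -- At the origin height, maximum and gap are 0, and `0 < k` puts it below the line. At fixed
  -- length the number of norths determines the endpoint.
  isPathTo⇔ : ∀ x y w → 0 < k → length w ≡ x + y →
    IsPathTo a c k (ℤ.+ x , ℤ.+ y) w ⇔ (norths w ≡ y × rise a c w 0 < k)
  isPathTo⇔ x y w 0<k len = mk⇔
    (λ (end , below) →
      ℤ.+-injective (cong proj₂ (trans (sym (endpoint-counts 0 0 w)) end)) ,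
      below⇒rise< w origin-invariant 0<k below)
    (λ (norths≡y , lt) →
      trans (endpoint-counts 0 0 w) (cong₂ (λ i j → ℤ.+ i , ℤ.+ j)
        (ℕ.+-cancelʳ-≡ (norths w) (easts w) x
          (trans (easts+norths≡length w) (trans len (cong (x +_) (sym norths≡y))))) norths≡y) ,
      rise<⇒below w origin-invariant lt)
    where
    origin-invariant : c * 0 + 0 ≡ 0 + a * 0
    origin-invariant = trans (ℕ.+-identityʳ _) (trans (ℕ.*-zeroʳ c) (sym (ℕ.*-zeroʳ a)))

-- Summation over the lines `k = suc i` up to `b`.

sum-applyUpTo-cong : ∀ {f g : ℕ → ℕ} b → (∀ i → f i ≡ g i) → sum (applyUpTo f b) ≡ sum (applyUpTo g b)
sum-applyUpTo-cong zero    f≡g = refl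
sum-applyUpTo-cong (suc b) f≡g = cong₂ _+_ (f≡g 0) (sum-applyUpTo-cong b (f≡g ∘ suc))

sum-applyUpTo-*ˡ : ∀ k f b → sum (applyUpTo (λ i → k * f i) b) ≡ k * sum (applyUpTo f b)
sum-applyUpTo-*ˡ k f zero    = sym (ℕ.*-zeroʳ k)
sum-applyUpTo-*ˡ k f (suc b) = trans (cong (k * f 0 +_) (sum-applyUpTo-*ˡ k (f ∘ suc) b))
                                     (sym (ℕ.*-distribˡ-+ k (f 0) _))

sum-𝟙< : ∀ m b → sum (applyUpTo (λ i → 𝟙 (m ℕ.<? suc i)) b) ≡ b ∸ m
sum-𝟙< m       zero    = sym (ℕ.0∸n≡0 m)
sum-𝟙< zero    (suc b) = cong suc (sum-𝟙< zero b)
sum-𝟙< (suc m) (suc b) = sum-𝟙< m b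

𝟙-× : ∀ {p q} {P : Set p} {Q : Set q} (P? : Dec P) (Q? : Dec Q) → 𝟙 (P? ×-dec Q?) ≡ 𝟙 P? * 𝟙 Q?
𝟙-× P? Q? with does P?
... | true  = sym (ℕ.+-identityʳ _)
... | false = refl

module _ (a c : ℕ) .{{_ : ℕ.NonZero c}} where

  -- The left side counts w with multiplicity b ∸ rise w 0, which is c ∸ gap w 0, the first gain
  -- of N ∷ w; words starting with E have first gain 0.
  sum-paths : ∀ b x y → a * x + b ≡ c * suc y →
    sum (applyUpTo (λ i → length (paths a c (suc i) (ℤ.+ x , ℤ.+ y))) b)
      ≡ ∑ (x + suc y) (λ w → 𝟙 (norths w ℕ.≟ suc y) * firstGain a c w)
  sum-paths b x y eq = begin
    sum (applyUpTo (λ i → length (paths a c (suc i) q)) b)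
      ≡⟨ sum-applyUpTo-cong b (λ i → length-filter-words (isPathTo? a c (suc i) q) (x + y)) ⟩
    sum (applyUpTo (λ i → ∑ (x + y) (𝟙 ∘ isPathTo? a c (suc i) q)) b)
      ≡⟨ ∑-sum (x + y) b (λ i → 𝟙 ∘ isPathTo? a c (suc i) q) ⟩
    ∑ (x + y) (λ w → sum (applyUpTo (λ i → 𝟙 (isPathTo? a c (suc i) q w)) b))
      ≡⟨ ∑-cong (x + y) multiplicity ⟩
    ∑ (x + y) (λ w → f (N ∷ w))
      ≡⟨ cong (_+ ∑ (x + y) (λ w → f (N ∷ w)))
           (trans (∑-cong (x + y) λ w _ → ℕ.*-zeroʳ (𝟙 (norths w ℕ.≟ suc y))) (∑-zero (x + y))) ⟨
    ∑ (suc (x + y)) f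
      ≡⟨ cong (λ n → ∑ n f) (ℕ.+-suc x y) ⟨
    ∑ (x + suc y) f ∎
    where
    open ≡-Reasoning
    q : Point
    q = ℤ.+ x , ℤ.+ y
    f : List Step → ℕ
    f w = 𝟙 (norths w ℕ.≟ suc y) * firstGain a c w

    -- The endpoint has height `r - γ`, and one North step further the height is `b`; hence
    -- `b - r = c - γ`. Adding `a * x` keeps this within the naturals.
    b∸rise : ∀ w → length w ≡ x + y → norths w ≡ y → b ∸ rise a c w 0 ≡ firstGain a c (N ∷ w)
    b∸rise w len refl = begin
      b ∸ r                       ≡⟨ ℕ.[m+n]∸[m+o]≡n∸o (a * x) b r ⟨
      (a * x + b) ∸ (a * x + r)   ≡⟨ cong₂ _∸_ (trans eq (trans (ℕ.*-suc c y) (ℕ.+-comm c (c * y)))) shift ⟩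
      (c * y + c) ∸ (c * y + γ)   ≡⟨ ℕ.[m+n]∸[m+o]≡n∸o (c * y) c γ ⟩
      c ∸ γ                       ≡⟨ cong (λ g → c ∸ gap a c w g) (ℕ.0∸n≡0 c) ⟨
      c ∸ gap a c w (0 ∸ c)       ∎
      where
      r = rise a c w 0
      γ = gap a c w 0
      easts≡x : easts w ≡ x
      easts≡x = ℕ.+-cancelʳ-≡ (norths w) (easts w) x (trans (easts+norths≡length w) len)
      shift : a * x + r ≡ c * y + γ
      shift = begin
        a * x + r             ≡⟨ ℕ.+-comm (a * x) r ⟩
        r + a * x             ≡⟨ cong₂ (λ i e → i + a * e) (ℕ.+-identityʳ r) easts≡x ⟨
        r + 0 + a * easts w   ≡⟨ rise-gap a c w 0 ⟩
        γ + c * y             ≡⟨ ℕ.+-comm γ (c * y) ⟩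
        c * y + γ             ∎

    multiplicity : ∀ w → length w ≡ x + y →
      sum (applyUpTo (λ i → 𝟙 (isPathTo? a c (suc i) q w)) b) ≡ f (N ∷ w)
    multiplicity w len = begin
      sum (applyUpTo (λ i → 𝟙 (isPathTo? a c (suc i) q w)) b)
        ≡⟨ sum-applyUpTo-cong b (λ i → trans
             (𝟙-cong (isPathTo⇔ a c (suc i) x y w (s≤s z≤n) len) (isPathTo? a c (suc i) q w)
                      ((norths w ℕ.≟ y) ×-dec (rise a c w 0 ℕ.<? suc i)))
             (𝟙-× (norths w ℕ.≟ y) (rise a c w 0 ℕ.<? suc i))) ⟩
      sum (applyUpTo (λ i → 𝟙 (norths w ℕ.≟ y) * 𝟙 (rise a c w 0 ℕ.<? suc i)) b)
        ≡⟨ sum-applyUpTo-*ˡ (𝟙 (norths w ℕ.≟ y)) (λ i → 𝟙 (rise a c w 0 ℕ.<? suc i)) b ⟩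
      𝟙 (norths w ℕ.≟ y) * sum (applyUpTo (λ i → 𝟙 (rise a c w 0 ℕ.<? suc i)) b)
        ≡⟨ cong (𝟙 (norths w ℕ.≟ y) *_) (sum-𝟙< (rise a c w 0) b) ⟩
      𝟙 (norths w ℕ.≟ y) * (b ∸ rise a c w 0)
        ≡⟨ weigh (norths w ℕ.≟ y) ⟩
      -- This is `f (N ∷ w)` by computation, as the extra `suc` on both sides does not alter the
      -- boolean.
      𝟙 (norths w ℕ.≟ y) * firstGain a c (N ∷ w) ∎
      where
      weigh : (d : Dec (norths w ≡ y)) → 𝟙 d * (b ∸ rise a c w 0) ≡ 𝟙 d * firstGain a c (N ∷ w)
      weigh (yes norths≡y) = cong (_+ 0) (b∸rise w len norths≡y)
      weigh (no _)         = refl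

  -- The integers `i`, `j`, `n`, `m` are variables so that matching on `refl` makes the absolute
  -- values, and with them the divisor, compute.
  sum-paths-formula : ∀ b x y → a * x + b ≡ c * suc y →
    ∀ {i j n m} → i ≡ ℤ.+ x → j ≡ ℤ.+ y → n ≡ ℤ.+ (x + suc y) → m ≡ ℤ.+ suc y →
    Σ (ℕ.NonZero ∣ n ∣) λ n≢0 →
      ℤ.+ sum (applyUpTo (λ k → length (paths a c (suc k) (i , j))) b) / 1
        ≡ (_/_ (ℤ.+ b) ∣ n ∣ {{n≢0}}) ℚ.* (ℤ.+ (∣ n ∣ C ∣ m ∣) / 1)
  sum-paths-formula b x y eq refl refl refl refl = n≢0 ,
    /1≡/*/1 (x + suc y) _ b ((x + suc y) C suc y) {{n≢0}}
      (trans (cong ((x + suc y) *_) (sum-paths b x y eq)) (cycle-lemma a c x (suc y) b eq))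
    where
    n≢0 : ℕ.NonZero (x + suc y)
    n≢0 = subst ℕ.NonZero (sym (ℕ.+-suc x y)) _

-- Endpoint coordinates as natural numbers, and the conclusion.

open import Data.Integer.Base using (+_)

theorem8p2 : (a b c : ℕ) .{{_ : ℕ.NonZero a}} .{{_ : ℕ.NonZero b}} .{{_ : ℕ.NonZero c}} →
    gcd a c ∣ b →
    (ra rc : ℤ) →
    ra ℤ.* + a ℤ.+ rc ℤ.* + c ≡ + b →
    (s : ℤ) →
    S₀ a c ra rc ℤ.≤ s →
    (0ℤ ℤ.≤ xEnd c ra s × 0ℤ ℤ.≤ yEnd a rc s) ×
    (let n = (+ a ℤ.+ + c) ℤ.* s ℤ.+ (rc ℤ.- ra)
         m = + a ℤ.* s ℤ.+ rc
     in Σ (ℕ.NonZero ∣ n ∣) λ n≢0 →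
          + sum (applyUpTo (λ i → A a c ra rc s (suc i)) b) / 1
            ≡ (_/_ (+ b) ∣ n ∣ {{n≢0}}) ℚ.* (+ (∣ n ∣ C ∣ m ∣) / 1))
theorem8p2 a b c _ ra rc bézout s S₀≤s =
  (0≤x , subst (0ℤ ℤ.≤_) (sym y≡) (ℤ.+≤+ z≤n)) ,
  sum-paths-formula a c b x y (line-eq (suc y) m≡) x≡ y≡ n≡ m≡
  where
  ra≤sc : ra ℤ.≤ s ℤ.* + c
  ra≤sc = ceiling[i/n]≤j⇒i≤j*n ra c s (ℤ.≤-trans (ℤ.i≤i⊔j _ _) S₀≤s)

  -rc≤sa : ℤ.- rc ℤ.≤ s ℤ.* + a
  -rc≤sa = ceiling[i/n]≤j⇒i≤j*n (ℤ.- rc) a s (ℤ.≤-trans (ℤ.i≤j⊔i (ceiling (ra / c)) _) S₀≤s)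

  0≤x : 0ℤ ℤ.≤ xEnd c ra s
  0≤x = ℤ.i≤j⇒0≤j-i (subst (ra ℤ.≤_) (ℤ.*-comm s (+ c)) ra≤sc)

  0≤m : 0ℤ ℤ.≤ + a ℤ.* s ℤ.+ rc
  0≤m = subst (0ℤ ℤ.≤_) (cong₂ ℤ._+_ (ℤ.*-comm s (+ a)) (ℤ.neg-involutive rc)) (ℤ.i≤j⇒0≤j-i -rc≤sa)

  x : ℕ
  x = ∣ xEnd c ra s ∣

  x≡ : xEnd c ra s ≡ + x
  x≡ = sym (ℤ.0≤i⇒+∣i∣≡i 0≤x)

  -- By the Bézout relation the endpoint followed by a North step has height `b`. `m` is arbitrary
  -- so that the same equation can exclude `m = 0`.
  line-eq : ∀ m → + a ℤ.* s ℤ.+ rc ≡ + m → a * x + b ≡ c * m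
  line-eq m m≡ = ℤ.+-injective (begin
    + (a * x) ℤ.+ + b                                            ≡⟨ cong₂ ℤ._+_ (ℤ.pos-* a x) (sym bézout) ⟩
    + a ℤ.* + x ℤ.+ (ra ℤ.* + a ℤ.+ rc ℤ.* + c)                  ≡⟨ cong (λ i → + a ℤ.* i ℤ.+ _) x≡ ⟨
    + a ℤ.* (+ c ℤ.* s ℤ.- ra) ℤ.+ (ra ℤ.* + a ℤ.+ rc ℤ.* + c)   ≡⟨ rearrange (+ a) (+ c) s ra rc ⟩
    + c ℤ.* (+ a ℤ.* s ℤ.+ rc)                                   ≡⟨ cong (+ c ℤ.*_) m≡ ⟩
    + c ℤ.* + m                                                  ≡⟨ ℤ.pos-* c m ⟨
    + (c * m)                                                    ∎)
    where
    open ≡-Reasoning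
    rearrange : ∀ a c s ra rc → a ℤ.* (c ℤ.* s ℤ.- ra) ℤ.+ (ra ℤ.* a ℤ.+ rc ℤ.* c) ≡ c ℤ.* (a ℤ.* s ℤ.+ rc)
    rearrange = ℤ-Solver.solve-∀

  m-positive : ∃[ y ] + a ℤ.* s ℤ.+ rc ≡ + suc y
  m-positive with ∣ + a ℤ.* s ℤ.+ rc ∣ | sym (ℤ.0≤i⇒+∣i∣≡i 0≤m)
  ... | suc y | m≡+suc = y , m≡+suc
  -- The bound on `s` gives only `0 ≤ m`; `m = 0` would force `a * x + b = 0`, against `b > 0`.
  ... | zero  | m≡0    = contradiction
    (ℕ.m+n≡0⇒n≡0 (a * x) (trans (line-eq 0 m≡0) (ℕ.*-zeroʳ c))) (ℕ.≢-nonZero⁻¹ b)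

  y : ℕ
  y = proj₁ m-positive

  m≡ : + a ℤ.* s ℤ.+ rc ≡ + suc y
  m≡ = proj₂ m-positive

  y≡ : yEnd a rc s ≡ + y
  y≡ = cong (ℤ._- 1ℤ) m≡

  n≡ : (+ a ℤ.+ + c) ℤ.* s ℤ.+ (rc ℤ.- ra) ≡ + (x + suc y)
  n≡ = trans (rearrange (+ a) (+ c) s ra rc) (cong₂ ℤ._+_ x≡ m≡)
    where
    rearrange : ∀ a c s ra rc → (a ℤ.+ c) ℤ.* s ℤ.+ (rc ℤ.- ra) ≡ (c ℤ.* s ℤ.- ra) ℤ.+ (a ℤ.* s ℤ.+ rc)
    rearrange = ℤ-Solver.solve-∀
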